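{- Let $\mathbf{R}=\langle R,+,\cdot,0,1,\alpha\rangle$ be an integral involutive near semiring and $e$ a central element of $\mathbf{R}$. Then $\mathbf{R}\cong\mathbf{[0,e]}\times\mathbf{[0,\alpha(e)]}$.
   Context: A near semiring is an algebra $\langle R,+,\cdot,0,1\rangle$ such that: (i) $\langle R,+,0\rangle$ is a commutative monoid; (ii) $x\cdot 1=x=1\cdot x$ (multiplication need not be associative or commutative); (iii) $(x+y)\cdot z=(x\cdot z)+(y\cdot z)$; (iv) $x\cdot 0=0\cdot x=0$. It is idempotent if $x+x=x$; then $x\le y$ iff $x+y=y$ defines a partial order, called the induced order. It is integral if $x+1=1$ for all $x$. An involutive near semiring is an idempotent near semiring with a map $\alpha:R\to R$ such that $\alpha(\alpha(x))=x$, and $x\le y$ implies $\alpha(y)\le\alpha(x)$. For $a,b\in R$, $\theta(a,b)$ denotes the congruence of $\mathbf{R}$ (with respect to $+,\cdot,\alpha,0,1$) generated by the pair $(a,b)$. An element $e\in R$ is central if $(\theta(e,0),\theta(e,1))$ is a pair of complementary factor congruences of $\mathbf{R}$, i.e. $\theta(e,0)\cap\theta(e,1)$ is the identity relation and $\theta(e,0)\circ\theta(e,1)=R\times R$. If $e$ is central, so is $\alpha(e)$. For a central element $e$, $[0,e]=\{x\in R: x\le e\}$ and $\mathbf{[0,e]}=\langle [0,e],+,\cdot,{}^{e},0,e\rangle$, where $+$ and $\cdot$ are the restrictions of the operations of $\mathbf{R}$, the unary operation (in the role of $\alpha$) is $x^{e}=e\cdot\alpha(x)$, and $e$ plays the role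 of the constant $1$. The algebra $\mathbf{[0,\alpha(e)]}$ is defined in the same way with $\alpha(e)$ in place of $e$. -}

module Defs where

open import Level using (Level; _⊔_; suc)
open import Algebra.Bundles.Raw using (RawSemiring)
open import Algebra.Core using (Op₁; Op₂)
import Algebra.Construct.DirectProduct as DirectProduct
import Algebra.Definitions as AlgebraDefinitions
import Algebra.Structures as AlgebraStructures
open import Algebra.Morphism.Definitions using (Homomorphic₁)
open import Algebra.Morphism.Structures using (module SemiringMorphisms)
open import Data.Product.Base using (Σ; ∃; _×_; _,_; proj₁; proj₂; map)
open import Relation.Binary.Bundles using (Setoid)
open import Relation.Binary.Core using (Rel; _⇔_)
open import Relation.Binary.Construct.Composition using (_;_)
open import Relation.Binary.Construct.Intersection using (_∩_)
open import Relation.Binary.Definitions using (Antitonic₁; Universal)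
import Relation.Binary.Reasoning.Setoid as SetoidReasoning

private
  variable
    c ℓ c₁ ℓ₁ c₂ ℓ₂ : Level

-- Algebras of signature (+, ·, α, 0, 1), without laws; the paper's · is _*_.
record RawInvolutiveSemiring c ℓ : Set (suc (c ⊔ ℓ)) where
  field
    rawSemiring : RawSemiring c ℓ
  open RawSemiring rawSemiring public
  field
    α : Op₁ Carrier

module _ (A : RawInvolutiveSemiring c₁ ℓ₁) (B : RawInvolutiveSemiring c₂ ℓ₂) where
  private
    module A = RawInvolutiveSemiring A
    module B = RawInvolutiveSemiring B
  open SemiringMorphisms A.rawSemiring B.rawSemiring

  record IsInvolutiveSemiringIsomorphism (⟦_⟧ : A.Carrier → B.Carrier)
         : Set (c₁ ⊔ ℓ₁ ⊔ c₂ ⊔ ℓ₂) where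
    field
      isSemiringIsomorphism : IsSemiringIsomorphism ⟦_⟧
      α-homo                : Homomorphic₁ A.Carrier B.Carrier B._≈_ ⟦_⟧ A.α B.α
    open IsSemiringIsomorphism isSemiringIsomorphism public

  infix 4 _≅_
  _≅_ : Set (c₁ ⊔ ℓ₁ ⊔ c₂ ⊔ ℓ₂)
  _≅_ = ∃ IsInvolutiveSemiringIsomorphism

infixr 5 _⊗_
_⊗_ : RawInvolutiveSemiring c₁ ℓ₁ → RawInvolutiveSemiring c₂ ℓ₂ →
      RawInvolutiveSemiring (c₁ ⊔ c₂) (ℓ₁ ⊔ ℓ₂)
A ⊗ B = record
  { rawSemiring = DirectProduct.rawSemiring A.rawSemiring B.rawSemiring
  ; α           = map A.α B.α
  }
  where
  module A = RawInvolutiveSemiring A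
  module B = RawInvolutiveSemiring B

module _ {a ℓ} {A : Set a} (_≈_ : Rel A ℓ) where
  open AlgebraDefinitions _≈_
  open AlgebraStructures _≈_ using (IsCommutativeMonoid; IsUnitalMagma)

  -- Unlike the library's IsNearSemiring, this has a unit for *, commutative +
  -- and a two-sided zero, and does not require * to be associative.
  record IsNearSemiring (_+_ _*_ : Op₂ A) (0# 1# : A) : Set (a ⊔ ℓ) where
    field
      +-isCommutativeMonoid : IsCommutativeMonoid _+_ 0#
      *-isUnitalMagma       : IsUnitalMagma _*_ 1#
      distribʳ              : _*_ DistributesOverʳ _+_
      zero                  : Zero 0# _*_

    open IsCommutativeMonoid +-isCommutativeMonoid public
      using (isEquivalence; setoid; refl; sym; trans)
      renaming
        ( ∙-cong to +-cong; assoc to +-assoc; comm to +-comm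
        ; identityˡ to +-identityˡ; identityʳ to +-identityʳ
        )
    open IsUnitalMagma *-isUnitalMagma public
      using ()
      renaming
        ( ∙-cong to *-cong
        ; identityˡ to *-identityˡ; identityʳ to *-identityʳ
        )

    zeroˡ : LeftZero 0# _*_
    zeroˡ = proj₁ zero

    zeroʳ : RightZero 0# _*_
    zeroʳ = proj₂ zero

  InducedOrder : Op₂ A → Rel A ℓ
  InducedOrder _+_ x y = (x + y) ≈ y

  record IsInvolutiveNearSemiring (_+_ _*_ : Op₂ A) (α : Op₁ A) (0# 1# : A)
         : Set (a ⊔ ℓ) where
    field
      isNearSemiring : IsNearSemiring _+_ _*_ 0# 1#
      +-idem         : Idempotent _+_
      α-cong         : Congruent₁ α
      α-involutive   : Involutive α
      α-antitone     : Antitonic₁ (InducedOrder _+_) (InducedOrder _+_) α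
    open IsNearSemiring isNearSemiring public

  record IsIntegralInvolutiveNearSemiring
         (_+_ _*_ : Op₂ A) (α : Op₁ A) (0# 1# : A) : Set (a ⊔ ℓ) where
    field
      isInvolutiveNearSemiring : IsInvolutiveNearSemiring _+_ _*_ α 0# 1#
      integral                 : RightZero 1# _+_
    open IsInvolutiveNearSemiring isInvolutiveNearSemiring public

record IntegralInvolutiveNearSemiring c ℓ : Set (suc (c ⊔ ℓ)) where
  field
    raw : RawInvolutiveSemiring c ℓ
  open RawInvolutiveSemiring raw public
  field
    isIntegralInvolutiveNearSemiring :
      IsIntegralInvolutiveNearSemiring _≈_ _+_ _*_ α 0# 1#
  open IsIntegralInvolutiveNearSemiring isIntegralInvolutiveNearSemiring public

  infix 4 _≤_
  _≤_ : Rel Carrier ℓ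
  _≤_ = InducedOrder _≈_ _+_

module _ (R : RawInvolutiveSemiring c ℓ) where
  open RawInvolutiveSemiring R

  -- The congruence generated by the pair (a , b).
  data θ (a b : Carrier) : Rel Carrier (c ⊔ ℓ) where
    generator : θ a b a b
    reflexive : ∀ {x y} → x ≈ y → θ a b x y
    symmetric : ∀ {x y} → θ a b x y → θ a b y x
    transitive : ∀ {x y z} → θ a b x y → θ a b y z → θ a b x z
    +-compatible : ∀ {x x′ y y′} → θ a b x x′ → θ a b y y′ → θ a b (x + y) (x′ + y′)
    *-compatible : ∀ {x x′ y y′} → θ a b x x′ → θ a b y y′ → θ a b (x * y) (x′ * y′)
    α-compatible : ∀ {x x′} → θ a b x x′ → θ a b (α x) (α x′)

  record Central (e : Carrier) : Set (c ⊔ ℓ) where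
    field
      intersection : (θ e 0# ∩ θ e 1#) ⇔ _≈_
      composition  : Universal (θ e 0# ; θ e 1#)

module _ (R : IntegralInvolutiveNearSemiring c ℓ) where
  open IntegralInvolutiveNearSemiring R
  open SetoidReasoning setoid

  0≤ : ∀ x → 0# ≤ x
  0≤ = +-identityˡ

  ≤-trans : ∀ {x y z} → x ≤ y → y ≤ z → x ≤ z
  ≤-trans {x} {y} {z} x≤y y≤z = begin
    x + z        ≈⟨ +-cong refl y≤z ⟨
    x + (y + z)  ≈⟨ +-assoc x y z ⟨
    (x + y) + z  ≈⟨ +-cong x≤y refl ⟩
    y + z        ≈⟨ y≤z ⟩
    z            ∎

  +-≤ : ∀ {x y z} → x ≤ z → y ≤ z → x + y ≤ z
  +-≤ {x} {y} {z} x≤z y≤z = begin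
    (x + y) + z  ≈⟨ +-assoc x y z ⟩
    x + (y + z)  ≈⟨ +-cong refl y≤z ⟩
    x + z        ≈⟨ x≤z ⟩
    z            ∎

  x*y≤y : ∀ x y → x * y ≤ y
  x*y≤y x y = begin
    x * y + y       ≈⟨ +-cong refl (*-identityˡ y) ⟨
    x * y + 1# * y  ≈⟨ distribʳ y x 1# ⟨
    (x + 1#) * y    ≈⟨ *-cong (integral x) refl ⟩
    1# * y          ≈⟨ *-identityˡ y ⟩
    y               ∎

  α-0# : α 0# ≈ 1#
  α-0# = begin
    α 0#               ≈⟨ α-antitone (0≤ (α 1#)) ⟨
    α (α 1#) + α 0#    ≈⟨ +-cong (α-involutive 1#) refl ⟩
    1# + α 0#          ≈⟨ +-comm 1# (α 0#) ⟩
    α 0# + 1#          ≈⟨ integral (α 0#) ⟩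
    1#                 ∎

  α-1# : α 1# ≈ 0#
  α-1# = trans (α-cong (sym α-0#)) (α-involutive 0#)

  central⇒e*x≤e : ∀ {e} → Central raw e → ∀ x → e * x ≤ e
  central⇒e*x≤e {e} central x = proj₁ (Central.intersection central)
    ( transitive (+-compatible (*-compatible generator (reflexive refl)) generator)
        (transitive (reflexive (trans (+-identityʳ (0# * x)) (zeroˡ x)))
          (symmetric generator))
    , transitive (+-compatible (*-compatible generator (reflexive refl)) generator)
        (transitive (reflexive (integral (1# * x))) (symmetric generator))
    )

  θ-least : ∀ {a b a′ b′} → θ raw a b a′ b′ → ∀ {x y} → θ raw a′ b′ x y → θ raw a b x y
  θ-least p generator          = p
  θ-least p (reflexive x≈y)    = reflexive x≈y
  θ-least p (symmetric q)      = symmetric (θ-least p q)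
  θ-least p (transitive q r)   = transitive (θ-least p q) (θ-least p r)
  θ-least p (+-compatible q r) = +-compatible (θ-least p q) (θ-least p r)
  θ-least p (*-compatible q r) = *-compatible (θ-least p q) (θ-least p r)
  θ-least p (α-compatible q)   = α-compatible (θ-least p q)

  α-central : ∀ {e} → Central raw e → Central raw (α e)
  α-central {e} central = record
    { intersection =
        (λ (p , q) → intersection .proj₁ (θ-least αe∼1 q , θ-least αe∼0 p))
      , (λ x≈y → reflexive x≈y , reflexive x≈y)
    ; composition = λ x y →
        let z , p , q = composition y x
        in  z , symmetric (θ-least e∼1 q) , symmetric (θ-least e∼0 p)
    }
    where
    open Central central

    αe∼1 : θ raw e 0# (α e) 1#
    αe∼1 = transitive (α-compatible generator) (reflexive α-0#)

    αe∼0 : θ raw e 1# (α e) 0#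
    αe∼0 = transitive (α-compatible generator) (reflexive α-1#)

    e∼0 : θ raw (α e) 1# e 0#
    e∼0 = transitive (reflexive (sym (α-involutive e)))
            (transitive (α-compatible generator) (reflexive α-1#))

    e∼1 : θ raw (α e) 0# e 1#
    e∼1 = transitive (reflexive (sym (α-involutive e)))
            (transitive (α-compatible generator) (reflexive α-0#))

  -- The algebra [0 , e]; centrality of e gives closure under x ↦ e * α x.
  interval : (e : Carrier) → Central raw e → RawInvolutiveSemiring (c ⊔ ℓ) ℓ
  interval e central = record
    { rawSemiring = record
      { Carrier = Σ Carrier (_≤ e)
      ; _≈_     = λ x y → proj₁ x ≈ proj₁ y
      ; _+_     = λ (x , x≤e) (y , y≤e) → x + y , +-≤ x≤e y≤e
      ; _*_     = λ (x , x≤e) (y , y≤e) → x * y , ≤-trans (x*y≤y x y) y≤e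
      ; 0#      = 0# , 0≤ e
      ; 1#      = e , +-idem e
      }
    ; α = λ (x , _) → e * α x , central⇒e*x≤e central (α x)
    }

{-# OPTIONS --safe #-}
-- Since θ(e,0) ∩ θ(e,1) is the identity, an equation may be checked twice: once
-- with e replaced by 0 and once with e replaced by 1.  In this way x ↦ e * x is
-- a homomorphism onto [0 , e], and x ↦ (e * x , α e * x) is an isomorphism with
-- inverse (a , b) ↦ a + b.
module Submission where

open import Defs
open import Data.Product.Base using (_,_; proj₁)

module _ {c ℓ} (R : IntegralInvolutiveNearSemiring c ℓ) where
  open IntegralInvolutiveNearSemiring R

  e*x∼0 : ∀ e x → θ raw e 0# (e * x) 0#
  e*x∼0 e x = transitive (*-compatible generator (reflexive refl)) (reflexive (zeroˡ x))

  e*x∼x : ∀ e x → θ raw e 1# (e * x) x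
  e*x∼x e x = transitive (*-compatible generator (reflexive refl)) (reflexive (*-identityˡ x))

  -- The class of `0#` is a down-set: `x = x + 0# ∼ x + y = y ∼ 0#`.
  below-zero-class : ∀ {a b x y} → x ≤ y → θ raw a b y 0# → θ raw a b x 0#
  below-zero-class {x = x} x≤y y∼0 =
    transitive (reflexive (sym (+-identityʳ x)))
      (transitive (+-compatible (reflexive refl) (symmetric y∼0))
        (transitive (reflexive x≤y) y∼0))

  αe∼0 : ∀ e → θ raw e 1# (α e) 0#
  αe∼0 e = transitive (α-compatible generator) (reflexive (α-1# R))

  -- Modulo `θ(e,1)`, multiplying by `e` changes nothing, so `e * x` determines the class of `x`.
  cancel-modulo : ∀ e {x y} → e * x ≈ e * y → θ raw e 1# x y
  cancel-modulo e {x} {y} ex≈ey =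
    transitive (symmetric (e*x∼x e x)) (transitive (reflexive ex≈ey) (e*x∼x e y))

  module _ {e} (central : Central raw e) where

    ≈-from-θ : ∀ {x y} → θ raw e 0# x y → θ raw e 1# x y → x ≈ y
    ≈-from-θ p q = Central.intersection central .proj₁ (p , q)

    -- Distributivity is an axiom only on the other side. Here both sides collapse to `0#` modulo
    -- `θ(e,0)` and to `x + y` modulo `θ(e,1)`.
    e*-distrib-+ : ∀ x y → e * (x + y) ≈ e * x + e * y
    e*-distrib-+ x y = ≈-from-θ
      (transitive (e*x∼0 e (x + y))
        (symmetric (transitive (+-compatible (e*x∼0 e x) (e*x∼0 e y))
          (reflexive (+-identityˡ 0#)))))
      (transitive (e*x∼x e (x + y)) (symmetric (+-compatible (e*x∼x e x) (e*x∼x e y))))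

    e*-distrib-* : ∀ x y → e * (x * y) ≈ (e * x) * (e * y)
    e*-distrib-* x y = ≈-from-θ
      (transitive (e*x∼0 e (x * y))
        (symmetric (transitive (*-compatible (e*x∼0 e x) (e*x∼0 e y))
          (reflexive (zeroˡ 0#)))))
      (transitive (e*x∼x e (x * y)) (symmetric (*-compatible (e*x∼x e x) (e*x∼x e y))))

    -- The right side is the involution of `[0 , e]` applied to the image of `x`, so this is
    -- compatibility with `α`.
    e*-α-homo : ∀ x → e * α x ≈ e * α (e * x)
    e*-α-homo x = ≈-from-θ
      (transitive (e*x∼0 e (α x)) (symmetric (e*x∼0 e (α (e * x)))))
      -- Only the inner `e` has to become `1#`; the outer factor is common to both sides.
      (*-compatible (reflexive refl) (α-compatible (symmetric (e*x∼x e x))))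

    -- Modulo `θ(e,0)`, `a` lies below `e ∼ 0#`, so both sides vanish. Modulo `θ(e,1)`, `b` lies
    -- below `α e ∼ α 1# = 0#`, which leaves `a`.
    e*[a+b]≈a : ∀ {a b} → a ≤ e → b ≤ α e → e * (a + b) ≈ a
    e*[a+b]≈a {a} {b} a≤e b≤αe = ≈-from-θ
      (transitive (e*x∼0 e (a + b)) (symmetric (below-zero-class a≤e generator)))
      (transitive (e*x∼x e (a + b))
        (transitive (+-compatible (reflexive refl) (below-zero-class b≤αe (αe∼0 e)))
          (reflexive (+-identityʳ a))))

    decomposition-injective : ∀ {x y} → e * x ≈ e * y → α e * x ≈ α e * y → x ≈ y
    decomposition-injective ex≈ey αex≈αey = ≈-from-θ
      -- Since `α e ∼ α 0# = 1#` modulo `θ(e,0)`, the congruence `θ(α e,1)` is contained in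
      -- `θ(e,0)`.
      (θ-least R αe∼1 (cancel-modulo (α e) αex≈αey))
      (cancel-modulo e ex≈ey)
      where
      αe∼1 : θ raw e 0# (α e) 1#
      αe∼1 = transitive (α-compatible generator) (reflexive (α-0# R))

theorem15 : ∀ {c ℓ} (R : IntegralInvolutiveNearSemiring c ℓ) →
    let open IntegralInvolutiveNearSemiring R in
    (e : Carrier) (central : Central raw e) →
    raw ≅ (interval R e central ⊗ interval R (α e) (α-central R central))
theorem15 R e central =
  (λ x → (e * x , central⇒e*x≤e R central x) , (α e * x , central⇒e*x≤e R αcentral x)) ,
  record
    { isSemiringIsomorphism = record
      { isSemiringMonomorphism = record
        { isSemiringHomomorphism = record
          { isNearSemiringHomomorphism = record
            { +-isMonoidHomomorphism = record
              { isMagmaHomomorphism = record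
                { isRelHomomorphism = record
                  { cong = λ x≈y → *-cong refl x≈y , *-cong refl x≈y }
                ; homo = λ x y → e*-distrib-+ R central x y , e*-distrib-+ R αcentral x y
                }
              ; ε-homo = zeroʳ e , zeroʳ (α e)
              }
            ; *-homo = λ x y → e*-distrib-* R central x y , e*-distrib-* R αcentral x y
            }
          ; 1#-homo = *-identityʳ e , *-identityʳ (α e)
          }
        ; injective = λ (p , q) → decomposition-injective R central p q
        }
      ; surjective = λ ((a , a≤e) , (b , b≤αe)) → a + b , λ z≈a+b →
            trans (*-cong refl z≈a+b) (e*[a+b]≈a R central a≤e b≤αe)
          -- For the second coordinate `α e` takes the role of `e` and the summands are swapped; the
          -- bound on `a` must then be read as `a ≤ α (α e)`.
          , trans (*-cong refl (trans z≈a+b (+-comm a b)))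
              (e*[a+b]≈a R αcentral b≤αe (≤-αα a≤e))
      }
    ; α-homo = λ x → e*-α-homo R central x , e*-α-homo R αcentral x
    }
  where
  open IntegralInvolutiveNearSemiring R

  αcentral : Central raw (α e)
  αcentral = α-central R central

  ≤-αα : ∀ {a} → a ≤ e → a ≤ α (α e)
  ≤-αα a≤e = trans (+-cong refl (α-involutive e)) (trans a≤e (sym (α-involutive e)))
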